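{- Let $K, H \subseteq \mathbb{R}^d$ be symmetric convex bodies, and assume that $L_{K+w}(s) = L_{H+w}(s)$ for all real $s > 0$ and all integer vectors $w \in \mathbb{Z}^d$. Then $K = H$.
   Context: A convex body in $\mathbb{R}^d$ is a convex, compact set with nonempty interior. A convex body $K$ is symmetric if, for every $x$, $x \in K$ if and only if $-x \in K$. For a convex body $K \subseteq \mathbb{R}^d$ and a real number $s > 0$, $sK = \{sx \mid x \in K\}$ and $L_K(s) = \#(sK \cap \mathbb{Z}^d)$ is the number of integer points in $sK$. For $w \in \mathbb{R}^d$, $K + w = \{x + w \mid x \in K\}$; thus $L_{K+w}(s) = \#(s(K+w) \cap \mathbb{Z}^d)$. -}

module Defs where

open import Algebra.Bundles using (CommutativeMonoid)
import Algebra.Properties.CommutativeSemigroup as CommutativeSemigroupProperties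
open import Axiom.ExcludedMiddle using (ExcludedMiddle)
open import Data.Integer.Base using (ℤ)
open import Data.List.Base using (List; length)
import Data.List.Membership.Propositional as List
open import Data.List.Relation.Unary.Any using (Any)
open import Data.List.Relation.Unary.Unique.Propositional using (Unique)
open import Data.Nat.Base as ℕ using (ℕ)
import Data.Nat.Properties as ℕ
open import Data.Product.Base using (Σ-syntax; ∃; ∃-syntax; _×_; _,_)
open import Data.Rational.Base as ℚ using (ℚ; 0ℚ; 1ℚ; ½; ∣_∣)
import Data.Rational.Properties as ℚ
open import Data.Vec.Base using (Vec; lookup)
open import Data.Vec.Functional using (Vector)
open import Function.Bundles using (_⇔_)
open import Level using (0ℓ)
open import Relation.Binary.Core using (Rel)
open import Relation.Binary.Definitions using (_Respects_)
open import Relation.Binary.PropositionalEquality using (_≡_; refl; sym; trans; cong; cong₂; subst; module ≡-Reasoning)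
open import Relation.Nullary.Decidable.Core using (yes; no)
open import Relation.Nullary.Negation.Core using (¬_)
open import Relation.Unary using (Pred; _∈_; _⊆_; ⋃; Satisfiable)

------------------------------------------------------------------------
-- Real numbers: Cauchy sequences of rationals, with equality _≃_

IsCauchy : (ℕ → ℚ) → Set
IsCauchy f = ∀ ε → 0ℚ ℚ.< ε →
  ∃[ N ] (∀ m n → N ℕ.≤ m → N ℕ.≤ n → ∣ f m ℚ.- f n ∣ ℚ.< ε)

-- Unfolding these proofs inside real expressions makes type checking very slow.
abstract

  half-pos : ∀ {ε} → 0ℚ ℚ.< ε → 0ℚ ℚ.< ½ ℚ.* ε
  half-pos {ε} 0<ε =
    ℚ.positive⁻¹ _ {{ℚ.pos*pos⇒pos ½ ε {{ℚ.positive 0<ε}}}}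

  half+half : ∀ ε → ½ ℚ.* ε ℚ.+ ½ ℚ.* ε ≡ ε
  half+half ε = trans (sym (ℚ.*-distribʳ-+ ε ½ ½)) (ℚ.*-identityˡ ε)

  +-cauchy : ∀ {f g} → IsCauchy f → IsCauchy g → IsCauchy (λ n → f n ℚ.+ g n)
  +-cauchy {f} {g} cf cg ε 0<ε with cf (½ ℚ.* ε) (half-pos 0<ε) | cg (½ ℚ.* ε) (half-pos 0<ε)
  ... | M , hf | N , hg = M ℕ.⊔ N , λ m n p q → begin-strict
    ∣ (f m ℚ.+ g m) ℚ.- (f n ℚ.+ g n) ∣
      ≡⟨ cong ∣_∣ (rearrange (f m) (g m) (f n) (g n)) ⟩
    ∣ (f m ℚ.- f n) ℚ.+ (g m ℚ.- g n) ∣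
      ≤⟨ ℚ.∣p+q∣≤∣p∣+∣q∣ (f m ℚ.- f n) (g m ℚ.- g n) ⟩
    ∣ f m ℚ.- f n ∣ ℚ.+ ∣ g m ℚ.- g n ∣
      <⟨ ℚ.+-mono-<
           (hf m n (ℕ.m⊔n≤o⇒m≤o M N p) (ℕ.m⊔n≤o⇒m≤o M N q))
           (hg m n (ℕ.m⊔n≤o⇒n≤o M N p) (ℕ.m⊔n≤o⇒n≤o M N q)) ⟩
    ½ ℚ.* ε ℚ.+ ½ ℚ.* ε
      ≡⟨ half+half ε ⟩
    ε ∎
    where
    open ℚ.≤-Reasoning
    rearrange : ∀ a b c d → (a ℚ.+ b) ℚ.- (c ℚ.+ d) ≡ (a ℚ.- c) ℚ.+ (b ℚ.- d)
    rearrange a b c d = trans (cong (a ℚ.+ b ℚ.+_) (ℚ.neg-distrib-+ c d))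
      (interchange a b (ℚ.- c) (ℚ.- d))
      where open CommutativeSemigroupProperties
              (CommutativeMonoid.commutativeSemigroup ℚ.+-0-commutativeMonoid)

  neg-cauchy : ∀ {f} → IsCauchy f → IsCauchy (λ n → ℚ.- f n)
  neg-cauchy {f} cf ε 0<ε with cf ε 0<ε
  ... | N , hf = N , λ m n p q →
    subst (ℚ._< ε)
      (trans (sym (ℚ.∣-p∣≡∣p∣ (f m ℚ.- f n))) (cong ∣_∣ (ℚ.neg-distrib-+ (f m) (ℚ.- f n))))
      (hf m n p q)

  sub-add : ∀ p q → (p ℚ.- q) ℚ.+ q ≡ p
  sub-add p q = trans (ℚ.+-assoc p (ℚ.- q) q)
    (trans (cong (p ℚ.+_) (ℚ.+-inverseˡ q)) (ℚ.+-identityʳ p))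

  eventually-bounded : ∀ {f} → IsCauchy f →
    ∃[ B ] (0ℚ ℚ.< B × ∃[ N ] (∀ n → N ℕ.≤ n → ∣ f n ∣ ℚ.≤ B))
  eventually-bounded {f} cf with cf 1ℚ (ℚ.positive⁻¹ 1ℚ)
  ... | N , hf = 1ℚ ℚ.+ ∣ f N ∣ , ℚ.+-mono-<-≤ (ℚ.positive⁻¹ 1ℚ) (ℚ.0≤∣p∣ (f N)) ,
    N , λ n p → begin
      ∣ f n ∣                      ≡⟨ cong ∣_∣ (sym (sub-add (f n) (f N))) ⟩
      ∣ (f n ℚ.- f N) ℚ.+ f N ∣    ≤⟨ ℚ.∣p+q∣≤∣p∣+∣q∣ (f n ℚ.- f N) (f N) ⟩
      ∣ f n ℚ.- f N ∣ ℚ.+ ∣ f N ∣  ≤⟨ ℚ.+-monoˡ-≤ ∣ f N ∣ (ℚ.<⇒≤ (hf n N p ℕ.≤-refl)) ⟩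
      1ℚ ℚ.+ ∣ f N ∣               ∎
    where
    open ℚ.≤-Reasoning

  *-cauchy : ∀ {f g} → IsCauchy f → IsCauchy g → IsCauchy (λ n → f n ℚ.* g n)
  *-cauchy {f} {g} cf cg ε 0<ε with eventually-bounded cf | eventually-bounded cg
  ... | B , 0<B , M , bf | C , 0<C , N , bg = go (cf δ 0<δ) (cg δ 0<δ)
    where
    instance
      pos : ℚ.Positive (B ℚ.+ C)
      pos = ℚ.positive (ℚ.+-mono-< 0<B 0<C)
      nonZero : ℚ.NonZero (B ℚ.+ C)
      nonZero = ℚ.pos⇒nonZero (B ℚ.+ C)

    δ : ℚ
    δ = ℚ.1/ (B ℚ.+ C) ℚ.* ε

    0<δ : 0ℚ ℚ.< δ
    0<δ = ℚ.positive⁻¹ δ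
      {{ℚ.pos*pos⇒pos (ℚ.1/ (B ℚ.+ C)) {{ℚ.1/pos⇒pos (B ℚ.+ C)}} ε {{ℚ.positive 0<ε}}}}

    δ-sum : B ℚ.* δ ℚ.+ C ℚ.* δ ≡ ε
    δ-sum = trans (sym (ℚ.*-distribʳ-+ δ B C))
      (trans (sym (ℚ.*-assoc (B ℚ.+ C) (ℚ.1/ (B ℚ.+ C)) ε))
      (trans (cong (ℚ._* ε) (ℚ.*-inverseʳ (B ℚ.+ C))) (ℚ.*-identityˡ ε)))

    rearrange : ∀ a b c d → a ℚ.* b ℚ.- c ℚ.* d ≡ a ℚ.* (b ℚ.- d) ℚ.+ d ℚ.* (a ℚ.- c)
    rearrange a b c d = sym (begin
      a ℚ.* (b ℚ.- d) ℚ.+ d ℚ.* (a ℚ.- c)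
        ≡⟨ cong₂ ℚ._+_ (distrib a b d) (distrib d a c) ⟩
      (a ℚ.* b ℚ.- a ℚ.* d) ℚ.+ (d ℚ.* a ℚ.- d ℚ.* c)
        ≡⟨ cong₂ (λ u v → (a ℚ.* b ℚ.- a ℚ.* d) ℚ.+ (u ℚ.- v)) (ℚ.*-comm d a) (ℚ.*-comm d c) ⟩
      (a ℚ.* b ℚ.- a ℚ.* d) ℚ.+ (a ℚ.* d ℚ.- c ℚ.* d)
        ≡⟨ ℚ.+-assoc (a ℚ.* b ℚ.- a ℚ.* d) (a ℚ.* d) (ℚ.- (c ℚ.* d)) ⟨
      (a ℚ.* b ℚ.- a ℚ.* d) ℚ.+ a ℚ.* d ℚ.- c ℚ.* d
        ≡⟨ cong (ℚ._- c ℚ.* d) (sub-add (a ℚ.* b) (a ℚ.* d)) ⟩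
      a ℚ.* b ℚ.- c ℚ.* d ∎)
      where
      open ≡-Reasoning
      distrib : ∀ x y z → x ℚ.* (y ℚ.- z) ≡ x ℚ.* y ℚ.- x ℚ.* z
      distrib x y z = trans (ℚ.*-distribˡ-+ x y (ℚ.- z))
        (cong (x ℚ.* y ℚ.+_) (sym (ℚ.neg-distribʳ-* x z)))

    term : ∀ a b {A} → 0ℚ ℚ.< A → ∣ a ∣ ℚ.≤ A → ∣ b ∣ ℚ.< δ → ∣ a ℚ.* b ∣ ℚ.< A ℚ.* δ
    term a b {A} 0<A a≤A b<δ = begin-strict
      ∣ a ℚ.* b ∣      ≡⟨ ℚ.∣p*q∣≡∣p∣*∣q∣ a b ⟩
      ∣ a ∣ ℚ.* ∣ b ∣  ≤⟨ ℚ.*-monoʳ-≤-nonNeg ∣ b ∣ {{ℚ.nonNegative (ℚ.0≤∣p∣ b)}} a≤A ⟩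
      A ℚ.* ∣ b ∣      <⟨ ℚ.*-monoʳ-<-pos A {{ℚ.positive 0<A}} b<δ ⟩
      A ℚ.* δ          ∎
      where open ℚ.≤-Reasoning

    go : ∃[ P ] (∀ m n → P ℕ.≤ m → P ℕ.≤ n → ∣ f m ℚ.- f n ∣ ℚ.< δ) →
         ∃[ Q ] (∀ m n → Q ℕ.≤ m → Q ℕ.≤ n → ∣ g m ℚ.- g n ∣ ℚ.< δ) →
         ∃[ R ] (∀ m n → R ℕ.≤ m → R ℕ.≤ n → ∣ f m ℚ.* g m ℚ.- f n ℚ.* g n ∣ ℚ.< ε)
    go (P , hf) (Q , hg) = (M ℕ.⊔ N) ℕ.⊔ (P ℕ.⊔ Q) , λ m n p q →
      let
        MN≤m = ℕ.m⊔n≤o⇒m≤o (M ℕ.⊔ N) (P ℕ.⊔ Q) p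
        PQ≤m = ℕ.m⊔n≤o⇒n≤o (M ℕ.⊔ N) (P ℕ.⊔ Q) p
        MN≤n = ℕ.m⊔n≤o⇒m≤o (M ℕ.⊔ N) (P ℕ.⊔ Q) q
        PQ≤n = ℕ.m⊔n≤o⇒n≤o (M ℕ.⊔ N) (P ℕ.⊔ Q) q
      in begin-strict
      ∣ f m ℚ.* g m ℚ.- f n ℚ.* g n ∣
        ≡⟨ cong ∣_∣ (rearrange (f m) (g m) (f n) (g n)) ⟩
      ∣ f m ℚ.* (g m ℚ.- g n) ℚ.+ g n ℚ.* (f m ℚ.- f n) ∣
        ≤⟨ ℚ.∣p+q∣≤∣p∣+∣q∣ (f m ℚ.* (g m ℚ.- g n)) (g n ℚ.* (f m ℚ.- f n)) ⟩
      ∣ f m ℚ.* (g m ℚ.- g n) ∣ ℚ.+ ∣ g n ℚ.* (f m ℚ.- f n) ∣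
        <⟨ ℚ.+-mono-<
             (term (f m) (g m ℚ.- g n) 0<B (bf m (ℕ.m⊔n≤o⇒m≤o M N MN≤m))
               (hg m n (ℕ.m⊔n≤o⇒n≤o P Q PQ≤m) (ℕ.m⊔n≤o⇒n≤o P Q PQ≤n)))
             (term (g n) (f m ℚ.- f n) 0<C (bg n (ℕ.m⊔n≤o⇒n≤o M N MN≤n))
               (hf m n (ℕ.m⊔n≤o⇒m≤o P Q PQ≤m) (ℕ.m⊔n≤o⇒m≤o P Q PQ≤n))) ⟩
      B ℚ.* δ ℚ.+ C ℚ.* δ
        ≡⟨ δ-sum ⟩
      ε ∎
      where open ℚ.≤-Reasoning

record ℝ : Set where
  constructor mkℝ
  field
    seq    : ℕ → ℚ
    cauchy : IsCauchy seq

open ℝ public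

infix  4 _≃_ _<_ _≤_
infixl 6 _+_ _-_
infixl 7 _*_
infix  8 -_

_≃_ : Rel ℝ 0ℓ
x ≃ y = ∀ ε → 0ℚ ℚ.< ε → ∃[ N ] (∀ n → N ℕ.≤ n → ∣ seq x n ℚ.- seq y n ∣ ℚ.< ε)

_<_ : Rel ℝ 0ℓ
x < y = ∃[ ε ] (0ℚ ℚ.< ε × ∃[ N ] (∀ n → N ℕ.≤ n → seq x n ℚ.+ ε ℚ.< seq y n))

_≤_ : Rel ℝ 0ℓ
x ≤ y = ¬ (y < x)

_+_ : ℝ → ℝ → ℝ
x + y = mkℝ (λ n → seq x n ℚ.+ seq y n) (+-cauchy {seq x} {seq y} (cauchy x) (cauchy y))

-_ : ℝ → ℝ
- x = mkℝ (λ n → ℚ.- seq x n) (neg-cauchy {seq x} (cauchy x))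

_-_ : ℝ → ℝ → ℝ
x - y = x + (- y)

_*_ : ℝ → ℝ → ℝ
x * y = mkℝ (λ n → seq x n ℚ.* seq y n) (*-cauchy {seq x} {seq y} (cauchy x) (cauchy y))

fromℚ : ℚ → ℝ
fromℚ q = mkℝ (λ _ → q) λ ε 0<ε → 0 , λ _ _ _ _ →
  subst (ℚ._< ε) (cong ∣_∣ (sym (ℚ.+-inverseʳ q))) 0<ε

fromℤ : ℤ → ℝ
fromℤ z = fromℚ (z ℚ./ 1)

0ℝ 1ℝ : ℝ
0ℝ = fromℚ 0ℚ
1ℝ = fromℚ 1ℚ

------------------------------------------------------------------------
-- The space ℝᵈ

infix 8 ℝ^_
ℝ^_ : ℕ → Set
ℝ^ d = Vector ℝ d

module _ {d : ℕ} where

  infix  4 _≋_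
  infixl 6 _+ᵥ_
  infixr 7 _*ᵥ_
  infix  8 -ᵥ_

  _≋_ : Rel (ℝ^ d) 0ℓ
  x ≋ y = ∀ i → x i ≃ y i

  _+ᵥ_ : ℝ^ d → ℝ^ d → ℝ^ d
  (x +ᵥ y) i = x i + y i

  -ᵥ_ : ℝ^ d → ℝ^ d
  (-ᵥ x) i = - x i

  _*ᵥ_ : ℝ → ℝ^ d → ℝ^ d
  (s *ᵥ x) i = s * x i

  -- The open ball of the maximum norm; these balls form a basis of the
  -- usual topology of ℝᵈ.
  Ball : ℝ^ d → ℝ → Pred (ℝ^ d) 0ℓ
  Ball x r y = ∀ i → x i - r < y i × y i < x i + r

  Interior : Pred (ℝ^ d) 0ℓ → Pred (ℝ^ d) 0ℓ
  Interior A x = ∃[ r ] (0ℝ < r × Ball x r ⊆ A)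

  Open : Pred (ℝ^ d) 0ℓ → Set
  Open A = A ⊆ Interior A

  Compact : Pred (ℝ^ d) 0ℓ → Set₁
  Compact A = ∀ {I : Set} (U : I → Pred (ℝ^ d) 0ℓ) →
    (∀ i → Open (U i)) → A ⊆ ⋃ I U →
    Σ[ is ∈ List I ] (∀ {x} → x ∈ A → Any (λ i → x ∈ U i) is)

  Convex : Pred (ℝ^ d) 0ℓ → Set
  Convex A = ∀ {x y} → x ∈ A → y ∈ A →
    ∀ t → 0ℝ ≤ t → t ≤ 1ℝ → t *ᵥ x +ᵥ (1ℝ - t) *ᵥ y ∈ A

  Symmetric : Pred (ℝ^ d) 0ℓ → Set
  Symmetric A = ∀ x → x ∈ A ⇔ -ᵥ x ∈ A

  record IsConvexBody (K : Pred (ℝ^ d) 0ℓ) : Set₁ where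
    field
      -- K is a set of real vectors, not just of representing sequences.
      resp     : K Respects _≋_
      convex   : Convex K
      compact  : Compact K
      interior : Satisfiable (Interior K)

  infixr 7 _·_
  infixl 6 _⊕_

  _·_ : ℝ → Pred (ℝ^ d) 0ℓ → Pred (ℝ^ d) 0ℓ
  (s · A) y = ∃[ x ] (x ∈ A × y ≋ s *ᵥ x)

  _⊕_ : Pred (ℝ^ d) 0ℓ → ℝ^ d → Pred (ℝ^ d) 0ℓ
  (A ⊕ w) y = ∃[ x ] (x ∈ A × y ≋ x +ᵥ w)

  ι : Vec ℤ d → ℝ^ d
  ι z i = fromℤ (lookup z i)

------------------------------------------------------------------------
-- Counting lattice points

-- A duplicate-free enumeration rather than a bijection with Σ X A, since
-- A may have several proofs at the same element.
HasSize : {X : Set} → Pred X 0ℓ → ℕ → Set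
HasSize {X} A n = Σ[ xs ∈ List X ]
  (Unique xs × (∀ x → x List.∈ xs ⇔ x ∈ A) × length xs ≡ n)

-- The cardinality of a finite set; infinite sets get the junk value 0.
-- The lattice points of a bounded set are always finite in number.
# : ExcludedMiddle 0ℓ → {X : Set} → Pred X 0ℓ → ℕ
# em A with em {∃ (HasSize A)}
... | yes (n , _) = n
... | no  _       = 0

L : ExcludedMiddle 0ℓ → ∀ {d} → Pred (ℝ^ d) 0ℓ → ℝ → ℕ
L em {d} A s = # em {Vec ℤ d} (λ z → ι z ∈ s · A)

-- If x ∈ K and x ∉ H, then there is a rational point q = z/p in K that is not
-- in H, because H is closed and the interior of K is dense in K.  For w = mz
-- and s = 1/(m + 1/p) one has s(q + w) = z.  If m is large, then s is so small
-- that two points of s(K + w) ∪ s(H + w) never differ by a nonzero integer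
-- vector.  So z is the only possible lattice point of either set, and the two
-- counts are 1 and 0.
module Submission where

open import Axiom.ExcludedMiddle using (ExcludedMiddle)
open import Data.Fin.Base as Fin using (Fin)
open import Data.Integer.Base as ℤ using (ℤ)
import Data.Integer.Properties as ℤ
open import Data.List.Base as List using (List; []; _∷_)
open import Data.List.Relation.Unary.All as All using (All)
import Data.List.Relation.Unary.All.Properties as All
import Data.List.Relation.Unary.AllPairs as AllPairs
open import Data.List.Relation.Unary.Any as Any using (here; there)
open import Data.Nat.Base as ℕ using (ℕ)
import Data.Nat.Properties as ℕ
open import Data.Product.Base using (Σ-syntax; ∃; ∃-syntax; _×_; _,_; proj₁; proj₂)
open import Data.Rational.Base as ℚ using (ℚ; 0ℚ; 1ℚ; ½; ∣_∣)
import Data.Rational.Properties as ℚ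
open import Data.Rational.Unnormalised.Base as ℚᵘ using (mkℚᵘ; *≡*; *≤*; *<*)
import Data.Rational.Unnormalised.Properties as ℚᵘ
open import Data.Sum.Base using (_⊎_; inj₁; inj₂)
open import Data.Vec.Base as Vec using (Vec)
import Data.Vec.Properties as Vec
open import Function.Base using (_∘_)
open import Function.Bundles using (mk⇔; Equivalence)
open import Level using (0ℓ)
open import Relation.Binary.Definitions using (_Respects_)
open import Relation.Binary.PropositionalEquality using (_≡_; refl; sym; trans; cong; cong₂; subst; subst₂)
open import Relation.Nullary.Decidable.Core using (Dec; yes; no; dec⇒maybe)
open import Relation.Nullary.Negation.Core using (¬_; contradiction)
open import Relation.Unary using (Pred; _∈_; _∉_; _⊆_; _≐_; ∁; ⋃)
open import Tactic.RingSolver using (solve)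
open import Tactic.RingSolver.Core.AlmostCommutativeRing using (AlmostCommutativeRing; fromCommutativeRing)
open import Defs

-- Order and arithmetic of the rationals

ℚ-ring : AlmostCommutativeRing 0ℓ 0ℓ
ℚ-ring = fromCommutativeRing ℚ.+-*-commutativeRing λ x → dec⇒maybe (0ℚ ℚ.≟ x)

-- The hypothesis says a − b = p − q, with both sides moved so that no subtraction occurs.
<-shift : ∀ {p q a b} → p ℚ.< q → a ℚ.+ q ≡ b ℚ.+ p → a ℚ.< b
<-shift {p} {q} {a} {b} p<q eq = ℚ.≰⇒> λ b≤a →
  ℚ.<-irrefl (sym eq) (ℚ.<-≤-trans (ℚ.+-monoʳ-< b p<q) (ℚ.+-monoˡ-≤ q b≤a))

p≤∣p∣ : ∀ p → p ℚ.≤ ∣ p ∣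
p≤∣p∣ p with ℚ.≤-total 0ℚ p
... | inj₁ 0≤p = ℚ.≤-reflexive (sym (ℚ.0≤p⇒∣p∣≡p 0≤p))
... | inj₂ p≤0 = ℚ.≤-trans p≤0 (ℚ.0≤∣p∣ p)

*-pos : ∀ {p q} → 0ℚ ℚ.< p → 0ℚ ℚ.< q → 0ℚ ℚ.< p ℚ.* q
*-pos {p} {q} 0<p 0<q =
  ℚ.positive⁻¹ _ {{ℚ.pos*pos⇒pos p {{ℚ.positive 0<p}} q {{ℚ.positive 0<q}}}}

⊓-pos : ∀ {p q} → 0ℚ ℚ.< p → 0ℚ ℚ.< q → 0ℚ ℚ.< p ℚ.⊓ q
⊓-pos {p} {q} 0<p 0<q with ℚ.⊓-sel p q
... | inj₁ eq = subst (0ℚ ℚ.<_) (sym eq) 0<p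
... | inj₂ eq = subst (0ℚ ℚ.<_) (sym eq) 0<q

inverse : ∀ {p} → 0ℚ ℚ.< p → ∃[ u ] (0ℚ ℚ.< u × u ℚ.* p ≡ 1ℚ)
inverse {p} 0<p = ℚ.1/ p , ℚ.positive⁻¹ _ {{ℚ.1/pos⇒pos p}} , ℚ.*-inverseˡ p
  where
  instance
    pos : ℚ.Positive p
    pos = ℚ.positive 0<p
    nonZero : ℚ.NonZero p
    nonZero = ℚ.pos⇒nonZero p

inverse-cancel : ∀ u t a → u ℚ.* t ≡ 1ℚ → u ℚ.* (t ℚ.* a) ≡ a
inverse-cancel u t a ut≡1 =
  trans (sym (ℚ.*-assoc u t a)) (trans (cong (ℚ._* a) ut≡1) (ℚ.*-identityˡ a))

-- The witness is t = δ / (δ + |D|): it is at most 1 because |D| is nonnegative, and t |D| = δ - t δ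
-- falls short of δ.
small-multiple : ∀ D {δ} → 0ℚ ℚ.< δ →
  ∃[ t ] (0ℚ ℚ.< t × t ℚ.≤ 1ℚ × t ℚ.* D ℚ.< δ)
small-multiple D {δ} 0<δ with inverse 0<S
  where
  0<S : 0ℚ ℚ.< δ ℚ.+ ∣ D ∣
  0<S = ℚ.+-mono-<-≤ 0<δ (ℚ.0≤∣p∣ D)
... | u , 0<u , uS≡1 = t , 0<t , t≤1 , ℚ.≤-<-trans tD≤t∣D∣ t∣D∣<δ
  where
  t = δ ℚ.* u
  0<t = *-pos 0<δ 0<u
  tS≡δ : ∀ a → u ℚ.* (δ ℚ.+ a) ≡ 1ℚ → t ℚ.* (δ ℚ.+ a) ≡ δ
  tS≡δ a eq = trans (ℚ.*-assoc δ u (δ ℚ.+ a)) (trans (cong (δ ℚ.*_) eq) (ℚ.*-identityʳ δ))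
  t≤1 : t ℚ.≤ 1ℚ
  t≤1 = subst₂ ℚ._≤_ (ℚ.*-comm u δ) uS≡1
    (ℚ.*-monoˡ-≤-nonNeg u {{ℚ.nonNegative (ℚ.<⇒≤ 0<u)}}
      (subst (ℚ._≤ δ ℚ.+ ∣ D ∣) (ℚ.+-identityʳ δ) (ℚ.+-monoʳ-≤ δ (ℚ.0≤∣p∣ D))))
  tD≤t∣D∣ : t ℚ.* D ℚ.≤ t ℚ.* ∣ D ∣
  tD≤t∣D∣ = ℚ.*-monoˡ-≤-nonNeg t {{ℚ.nonNegative (ℚ.<⇒≤ 0<t)}} (p≤∣p∣ D)
  split : ∀ t a δ → t ℚ.* (δ ℚ.+ a) ≡ δ → t ℚ.* a ℚ.+ t ℚ.* δ ≡ δ ℚ.+ 0ℚ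
  split t a δ eq = trans (ring t a δ) (trans eq (sym (ℚ.+-identityʳ δ)))
    where
    ring : ∀ t a δ → t ℚ.* a ℚ.+ t ℚ.* δ ≡ t ℚ.* (δ ℚ.+ a)
    ring t a δ = solve (t ∷ a ∷ δ ∷ []) ℚ-ring
  t∣D∣<δ : t ℚ.* ∣ D ∣ ℚ.< δ
  t∣D∣<δ = <-shift (*-pos 0<t 0<δ) (split t ∣ D ∣ δ (tS≡δ ∣ D ∣ uS≡1))

upper-bound : ∀ ps → ∃[ B ] All (ℚ._≤ B) ps
upper-bound []       = 0ℚ , All.[]
upper-bound (p ∷ ps) with upper-bound ps
... | B , ps≤B = p ℚ.⊔ B , ℚ.p≤p⊔q p B All.∷ All.map (λ q≤B → ℚ.≤-trans q≤B (ℚ.p≤q⊔p p B)) ps≤B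

upper-boundᶠ : ∀ {d} (f : Fin d → ℚ) → ∃[ B ] (∀ i → f i ℚ.≤ B)
upper-boundᶠ f with upper-bound (List.tabulate f)
... | B , f≤B = B , All.tabulate⁻ f≤B

-- This extracts a single radius from a finite subcover in `compact⇒closed`; the value 1 for the
-- empty list is arbitrary.
positive-lower-bound : (ps : List (∃ (0ℚ ℚ.<_))) →
  ∃[ δ ] (0ℚ ℚ.< δ × All (λ p → δ ℚ.≤ proj₁ p) ps)
positive-lower-bound [] = 1ℚ , ℚ.positive⁻¹ 1ℚ , All.[]
positive-lower-bound ((p , 0<p) ∷ ps) with positive-lower-bound ps
... | δ , 0<δ , δ≤ps = p ℚ.⊓ δ , ⊓-pos 0<p 0<δ ,
  ℚ.p⊓q≤p p δ All.∷ All.map (ℚ.≤-trans (ℚ.p⊓q≤q p δ)) δ≤ps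

-- Closeness is kept as two inequalities without an absolute value, which can be added to others and
-- rearranged by `<-shift` and the ring solver.
record Near (ε p q : ℚ) : Set where
  constructor near
  field
    below : p ℚ.< q ℚ.+ ε
    above : q ℚ.< p ℚ.+ ε

open Near

∣-∣<⇒near : ∀ {ε} p q → ∣ p ℚ.- q ∣ ℚ.< ε → Near ε p q
∣-∣<⇒near {ε} p q h = near
  (<-shift (ℚ.≤-<-trans (p≤∣p∣ (p ℚ.- q)) h) (solve (p ∷ q ∷ ε ∷ []) ℚ-ring))
  (<-shift
    (ℚ.≤-<-trans (subst (ℚ.- (p ℚ.- q) ℚ.≤_) (ℚ.∣-p∣≡∣p∣ (p ℚ.- q)) (p≤∣p∣ (ℚ.- (p ℚ.- q)))) h)
    (solve (p ∷ q ∷ ε ∷ []) ℚ-ring))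

near⇒∣-∣< : ∀ {ε} p q → Near ε p q → ∣ p ℚ.- q ∣ ℚ.< ε
near⇒∣-∣< {ε} p q (near p<q+ε q<p+ε) with ℚ.∣p∣≡p∨∣p∣≡-p (p ℚ.- q)
... | inj₁ eq = subst (ℚ._< ε) (sym eq) (<-shift p<q+ε (solve (p ∷ q ∷ ε ∷ []) ℚ-ring))
... | inj₂ eq = subst (ℚ._< ε) (sym eq) (<-shift q<p+ε (solve (p ∷ q ∷ ε ∷ []) ℚ-ring))

-- Integers as rationals

int : ℤ → ℚ
int z = z ℚ./ 1

-- `int z` is normalised through a gcd that does not reduce for a variable `z`, so identities about
-- `int` are checked on unnormalised fractions.
toℚᵘ-int : ∀ z → ℚ.toℚᵘ (int z) ℚᵘ.≃ mkℚᵘ z 0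
toℚᵘ-int z = ℚ.toℚᵘ-fromℚᵘ (mkℚᵘ z 0)

int-+ : ∀ a b → int (a ℤ.+ b) ≡ int a ℚ.+ int b
int-+ a b = ℚ.toℚᵘ-injective (begin
  ℚ.toℚᵘ (int (a ℤ.+ b))                  ≈⟨ toℚᵘ-int (a ℤ.+ b) ⟩
  mkℚᵘ (a ℤ.+ b) 0                        ≈⟨ *≡* (cong (ℤ._* ℤ.1ℤ) (sym (cong₂ ℤ._+_ (ℤ.*-identityʳ a) (ℤ.*-identityʳ b)))) ⟩
  mkℚᵘ a 0 ℚᵘ.+ mkℚᵘ b 0                  ≈⟨ ℚᵘ.+-cong (toℚᵘ-int a) (toℚᵘ-int b) ⟨
  ℚ.toℚᵘ (int a) ℚᵘ.+ ℚ.toℚᵘ (int b)      ≈⟨ ℚ.toℚᵘ-homo-+ (int a) (int b) ⟨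
  ℚ.toℚᵘ (int a ℚ.+ int b)                ∎)
  where open ℚᵘ.≃-Reasoning

int-* : ∀ a b → int (a ℤ.* b) ≡ int a ℚ.* int b
int-* a b = ℚ.toℚᵘ-injective (begin
  ℚ.toℚᵘ (int (a ℤ.* b))                  ≈⟨ toℚᵘ-int (a ℤ.* b) ⟩
  mkℚᵘ a 0 ℚᵘ.* mkℚᵘ b 0                  ≈⟨ ℚᵘ.*-cong (toℚᵘ-int a) (toℚᵘ-int b) ⟨
  ℚ.toℚᵘ (int a) ℚᵘ.* ℚ.toℚᵘ (int b)      ≈⟨ ℚ.toℚᵘ-homo-* (int a) (int b) ⟨
  ℚ.toℚᵘ (int a ℚ.* int b)                ∎)
  where open ℚᵘ.≃-Reasoning

int-cancel-< : ∀ a b → int a ℚ.< int b → a ℤ.< b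
int-cancel-< a b a<b with ℚᵘ.<-respˡ-≃ (toℚᵘ-int a) (ℚᵘ.<-respʳ-≃ (toℚᵘ-int b) (ℚ.toℚᵘ-mono-< a<b))
... | *<* a1<b1 = subst₂ ℤ._<_ (ℤ.*-identityʳ a) (ℤ.*-identityʳ b) a1<b1

int<int+1⇒≤ : ∀ a b → int a ℚ.< int b ℚ.+ 1ℚ → a ℤ.≤ b
int<int+1⇒≤ a b a<b+1 = subst (a ℤ.≤_) (ℤ.pred-suc b)
  (ℤ.i<j⇒i≤pred[j] (int-cancel-< a (ℤ.suc b)
    (subst (int a ℚ.<_) (trans (ℚ.+-comm (int b) 1ℚ) (sym (int-+ ℤ.1ℤ b))) a<b+1)))

↧*p≡↥ : ∀ p → int (ℚ.↧ p) ℚ.* p ≡ int (ℚ.↥ p)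
↧*p≡↥ p@(ℚ.mkℚ n d _) = ℚ.toℚᵘ-injective (begin
  ℚ.toℚᵘ (int (ℚ.↧ p) ℚ.* p)          ≈⟨ ℚ.toℚᵘ-homo-* (int (ℚ.↧ p)) p ⟩
  ℚ.toℚᵘ (int (ℚ.↧ p)) ℚᵘ.* mkℚᵘ n d  ≈⟨ ℚᵘ.*-congʳ (toℚᵘ-int (ℚ.↧ p)) ⟩
  mkℚᵘ (ℚ.↧ p) 0 ℚᵘ.* mkℚᵘ n d        ≈⟨ *≡* cross ⟩
  mkℚᵘ n 0                            ≈⟨ toℚᵘ-int n ⟨
  ℚ.toℚᵘ (int n)                      ∎)
  where
  open ℚᵘ.≃-Reasoning
  cross : (ℤ.+[1+ d ] ℤ.* n) ℤ.* ℤ.1ℤ ≡ n ℤ.* ℤ.+[1+ d ℕ.+ 0 ]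
  cross = trans (ℤ.*-identityʳ _) (trans (ℤ.*-comm ℤ.+[1+ d ] n)
    (cong (λ k → n ℤ.* ℤ.+[1+ k ]) (sym (ℕ.+-identityʳ d))))

int-pos : ∀ n .{{_ : ℕ.NonZero n}} → 0ℚ ℚ.< int (ℤ.+ n)
int-pos n = ℚ.positive⁻¹ _ {{ℚ.normalize-pos n 1}}

-- The absolute value of the numerator suffices, since the denominator is at least 1.
archimedean : ∀ p → ∃[ n ] p ℚ.≤ int (ℤ.+ n)
archimedean p@(ℚ.mkℚ n d _) = ℤ.∣ n ∣ , ℚ.toℚᵘ-cancel-≤
  (ℚᵘ.≤-respʳ-≃ (ℚᵘ.≃-sym (toℚᵘ-int (ℤ.+ ℤ.∣ n ∣))) (*≤* (begin
    n ℤ.* ℤ.1ℤ                  ≡⟨ ℤ.*-identityʳ n ⟩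
    n                           ≤⟨ i≤∣i∣ n ⟩
    ℤ.+ ℤ.∣ n ∣                 ≤⟨ ℤ.+≤+ (ℕ.m≤m*n ℤ.∣ n ∣ (ℕ.suc d)) ⟩
    ℤ.+ (ℤ.∣ n ∣ ℕ.* ℕ.suc d)   ≡⟨ ℤ.pos-* ℤ.∣ n ∣ (ℕ.suc d) ⟩
    ℤ.+ ℤ.∣ n ∣ ℤ.* ℤ.+[1+ d ]  ∎)))
  where
  open ℤ.≤-Reasoning
  i≤∣i∣ : ∀ i → i ℤ.≤ ℤ.+ ℤ.∣ i ∣
  i≤∣i∣ (ℤ.+ _)    = ℤ.≤-refl
  i≤∣i∣ (ℤ.-[1+ _ ]) = ℤ.-≤+

-- The product of all denominators clears them; each further denominator `e` also multiplies the
-- numerators already found.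
common-denominator : ∀ {d} (q : Fin d → ℚ) →
  ∃[ p ] (0ℚ ℚ.< int p × Σ[ z ∈ (Fin d → ℤ) ] (∀ i → int p ℚ.* q i ≡ int (z i)))
common-denominator {ℕ.zero}  q = ℤ.1ℤ , int-pos 1 , (λ ()) , λ ()
common-denominator {ℕ.suc d} q with common-denominator (λ i → q (Fin.suc i))
... | p , 0<p , z , pq≡z = p ℤ.* e ,
  subst (0ℚ ℚ.<_) (sym (int-* p e)) (*-pos 0<p (int-pos (ℕ.suc (ℚ.denominator-1 q₀)))) , z′ , pq≡z′
  where
  q₀ = q Fin.zero
  e  = ℚ.↧ q₀
  z′ : Fin (ℕ.suc d) → ℤ
  z′ Fin.zero    = p ℤ.* ℚ.↥ q₀
  z′ (Fin.suc i) = z i ℤ.* e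

  pq≡z′ : ∀ i → int (p ℤ.* e) ℚ.* q i ≡ int (z′ i)
  pq≡z′ Fin.zero = trans (cong (ℚ._* q₀) (int-* p e)) (trans (ℚ.*-assoc (int p) (int e) q₀)
    (trans (cong (int p ℚ.*_) (↧*p≡↥ q₀)) (sym (int-* p (ℚ.↥ q₀)))))
  pq≡z′ (Fin.suc i) = trans (cong (ℚ._* q (Fin.suc i)) (int-* p e))
    (trans (swap (int p) (int e) (q (Fin.suc i)))
    (trans (cong (ℚ._* int e) (pq≡z i)) (sym (int-* (z i) e))))
    where
    swap : ∀ a b c → a ℚ.* b ℚ.* c ≡ a ℚ.* c ℚ.* b
    swap a b c = solve (a ∷ b ∷ c ∷ []) ℚ-ring

-- Real numbers

-- `_≃_` and `_<_` unfold to this form, so facts about reals are proved for rationals at one index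
-- and lifted by `ev-map` and `ev-zip`.
Eventually : (ℕ → Set) → Set
Eventually P = ∃[ N ] (∀ n → N ℕ.≤ n → P n)

module _ {P Q : ℕ → Set} where

  ev-map : (∀ n → P n → Q n) → Eventually P → Eventually Q
  ev-map f (N , h) = N , λ n N≤n → f n (h n N≤n)

  ev-zip : {R : ℕ → Set} → (∀ n → P n → Q n → R n) →
    Eventually P → Eventually Q → Eventually R
  ev-zip f (M , g) (N , h) = M ℕ.⊔ N , λ n M⊔N≤n →
    f n (g n (ℕ.m⊔n≤o⇒m≤o M N M⊔N≤n)) (h n (ℕ.m⊔n≤o⇒n≤o M N M⊔N≤n))

ev-const : {P : Set} → Eventually (λ _ → P) → P
ev-const (N , h) = h N ℕ.≤-refl

≡⇒≃ : ∀ x y → (∀ n → seq x n ≡ seq y n) → x ≃ y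
≡⇒≃ x y eq ε 0<ε = 0 , λ n _ →
  subst (ℚ._< ε) (sym (cong ∣_∣ (trans (cong (ℚ._- seq y n) (eq n)) (ℚ.+-inverseʳ (seq y n))))) 0<ε

<-weaken : ∀ x y x′ y′ → (∀ n → seq x′ n ℚ.≤ seq x n) → (∀ n → seq y n ℚ.≤ seq y′ n) →
  x < y → x′ < y′
<-weaken x y x′ y′ x′≤x y≤y′ (ε , 0<ε , h) = ε , 0<ε ,
  ev-map (λ n x+ε<y → ℚ.<-≤-trans (ℚ.≤-<-trans (ℚ.+-monoˡ-≤ ε (x′≤x n)) x+ε<y) (y≤y′ n)) h

fromℚ-mono-< : ∀ {p q} → p ℚ.< q → fromℚ p < fromℚ q
-- `_<_` asks for a strict inequality after the gap has been added, so only half of q - p can serve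
-- as the gap.
fromℚ-mono-< {p} {q} p<q = ½ ℚ.* (q ℚ.- p) , half-pos 0<q-p ,
  0 , λ _ _ → midpoint
  where
  0<q-p : 0ℚ ℚ.< q ℚ.- p
  0<q-p = <-shift p<q (solve (p ∷ q ∷ []) ℚ-ring)
  midpoint : p ℚ.+ ½ ℚ.* (q ℚ.- p) ℚ.< q
  midpoint = <-shift (half-pos 0<q-p) (solve (p ∷ q ∷ []) ℚ-ring)

-- The gap in `x < y` is itself the room: either side may move by less than it. This is what makes
-- sets cut out by strict inequalities open.
<-room : ∀ x y → x < y → ∃[ ε ] (0ℚ ℚ.< ε ×
  (∀ z → z < x + fromℚ ε → z < y) × (∀ z → y - fromℚ ε < z → x < z))
<-room x y (ε , 0<ε , h) = ε , 0<ε , left , right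
  where
  left : ∀ z → z < x + fromℚ ε → z < y
  left z (η , 0<η , k) = η , 0<η , ev-zip (λ _ → ℚ.<-trans) k h
  shift : ∀ {η} x y z → x ℚ.+ ε ℚ.< y → y ℚ.- ε ℚ.+ η ℚ.< z → x ℚ.+ η ℚ.< z
  shift {η} x y z p q = <-shift (ℚ.+-mono-< p q) (solve (x ∷ y ∷ z ∷ ε ∷ η ∷ []) ℚ-ring)
  right : ∀ z → y - fromℚ ε < z → x < z
  right z (η , 0<η , k) = η , 0<η ,
    ev-zip (λ n → shift (seq x n) (seq y n) (seq z n)) h k

approximate : ∀ x {ε} → 0ℚ ℚ.< ε → ∃[ q ] Eventually (λ n → Near ε (seq x n) q)
approximate x 0<ε with cauchy x _ 0<ε
... | N , h = seq x N , N , λ n N≤n → ∣-∣<⇒near (seq x n) (seq x N) (h n N N≤n ℕ.≤-refl)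

bounded : ∀ x → ∃[ B ] (fromℚ (ℚ.- B) < x × x < fromℚ B)
-- One unit covers the error of the approximation `q`, the other is the gap that `_<_` requires.
bounded x = 1ℚ ℚ.+ 1ℚ ℚ.+ ∣ q ∣ ,
  (1ℚ , 0<1 , ev-map (λ n k → lower 1ℚ (seq x n) ∣ q ∣ -q≤∣q∣ (above k)) h) ,
  (1ℚ , 0<1 , ev-map (λ n k → upper 1ℚ (seq x n) ∣ q ∣ (p≤∣p∣ q) (below k)) h)
  where
  0<1 : 0ℚ ℚ.< 1ℚ
  0<1 = ℚ.positive⁻¹ 1ℚ
  q = proj₁ (approximate x 0<1)
  h = proj₂ (approximate x 0<1)
  -q≤∣q∣ : ℚ.- q ℚ.≤ ∣ q ∣
  -q≤∣q∣ = subst (ℚ.- q ℚ.≤_) (ℚ.∣-p∣≡∣p∣ q) (p≤∣p∣ (ℚ.- q))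
  lower : ∀ {q} e a c → ℚ.- q ℚ.≤ c → q ℚ.< a ℚ.+ e → ℚ.- (e ℚ.+ e ℚ.+ c) ℚ.+ e ℚ.< a
  lower {q} e a c p r = <-shift (ℚ.+-mono-≤-< p r) (solve (e ∷ a ∷ q ∷ c ∷ []) ℚ-ring)
  upper : ∀ {q} e a c → q ℚ.≤ c → a ℚ.< q ℚ.+ e → a ℚ.+ e ℚ.< e ℚ.+ e ℚ.+ c
  upper {q} e a c p r = <-shift (ℚ.+-mono-≤-< p r) (solve (e ∷ a ∷ q ∷ c ∷ []) ℚ-ring)

-- Let q be rational and within η = ε / 4 of x - y. If |q| > 2η, then x and y differ by more than η
-- with a known sign, which is excluded. Otherwise |x - y| stays below 3η and hence below ε.
≮∧≯⇒≃ : ∀ x y → ¬ x < y → ¬ y < x → x ≃ y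
≮∧≯⇒≃ x y x≮y y≮x ε 0<ε =
  go (proj₁ qh) (proj₂ qh) (η ℚ.+ η ℚ.<? proj₁ qh) (proj₁ qh ℚ.<? ℚ.- (η ℚ.+ η))
  where
  η = ½ ℚ.* (½ ℚ.* ε)
  0<η : 0ℚ ℚ.< η
  0<η = half-pos (half-pos 0<ε)
  4η≡ε : (η ℚ.+ η) ℚ.+ (η ℚ.+ η) ≡ ε
  4η≡ε = trans (cong₂ ℚ._+_ (half+half (½ ℚ.* ε)) (half+half (½ ℚ.* ε))) (half+half ε)
  qh = approximate (x - y) 0<η

  apart : ∀ η a b q → Near η (a ℚ.- b) q → η ℚ.+ η ℚ.< q → b ℚ.+ η ℚ.< a
  apart η a b q k p = <-shift (ℚ.+-mono-< p (above k)) (solve (a ∷ b ∷ q ∷ η ∷ []) ℚ-ring)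
  apart′ : ∀ η a b q → Near η (a ℚ.- b) q → q ℚ.< ℚ.- (η ℚ.+ η) → a ℚ.+ η ℚ.< b
  apart′ η a b q k p = <-shift (ℚ.+-mono-< p (below k)) (solve (a ∷ b ∷ q ∷ η ∷ []) ℚ-ring)
  close : ∀ η a b q → 0ℚ ℚ.< η → Near η (a ℚ.- b) q →
    q ℚ.≤ η ℚ.+ η → ℚ.- (η ℚ.+ η) ℚ.≤ q → Near ((η ℚ.+ η) ℚ.+ (η ℚ.+ η)) a b
  close η a b q 0<η k p r = near
    (<-shift (ℚ.+-mono-< (ℚ.+-mono-<-≤ (below k) p) 0<η) (solve (a ∷ b ∷ q ∷ η ∷ []) ℚ-ring))
    (<-shift (ℚ.+-mono-< (ℚ.+-mono-<-≤ (above k) r) 0<η) (solve (a ∷ b ∷ q ∷ η ∷ []) ℚ-ring))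

  go : ∀ q → Eventually (λ n → Near η (seq x n ℚ.- seq y n) q) →
    Dec (η ℚ.+ η ℚ.< q) → Dec (q ℚ.< ℚ.- (η ℚ.+ η)) →
    Eventually (λ n → ∣ seq x n ℚ.- seq y n ∣ ℚ.< ε)
  go q h (yes p) _ = contradiction
    (η , 0<η , ev-map (λ n k → apart η (seq x n) (seq y n) q k p) h) y≮x
  go q h (no _) (yes p) = contradiction
    (η , 0<η , ev-map (λ n k → apart′ η (seq x n) (seq y n) q k p) h) x≮y
  go q h (no p) (no r) = ev-map (λ n k → near⇒∣-∣< _ _ (subst (λ e → Near e (seq x n) (seq y n)) 4η≡ε
    (close η (seq x n) (seq y n) q 0<η k (ℚ.≮⇒≥ p) (ℚ.≮⇒≥ r)))) h

<⇒eventually : ∀ x y → x < y → Eventually (λ n → seq x n ℚ.< seq y n)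
<⇒eventually x y (ε , 0<ε , h) = ev-map
  (λ n → ℚ.<-trans (subst (ℚ._< seq x n ℚ.+ ε) (ℚ.+-identityʳ (seq x n)) (ℚ.+-monoʳ-< (seq x n) 0<ε))) h

<-asym : ∀ x y → x < y → ¬ y < x
<-asym x y x<y y<x =
  ev-const (ev-zip (λ _ → ℚ.<-asym) (<⇒eventually x y x<y) (<⇒eventually y x y<x))

fromℚ-mono-≤ : ∀ {p q} → p ℚ.≤ q → fromℚ p ≤ fromℚ q
fromℚ-mono-≤ {p} {q} p≤q q<p =
  ℚ.<-irrefl refl (ℚ.<-≤-trans (ev-const (<⇒eventually (fromℚ q) (fromℚ p) q<p)) p≤q)

-- Half of the gap becomes δ; the other half remains as the gap of the new inequalities.
<-split : ∀ x y → x < y → ∃[ δ ] (0ℚ ℚ.< δ × x < y - fromℚ δ × x + fromℚ δ < y)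
<-split x y (ε , 0<ε , h) = ½ ℚ.* ε , half-pos 0<ε ,
  (½ ℚ.* ε , half-pos 0<ε , ev-map (λ n k → left (seq x n) (seq y n) (shrink (seq x n) k)) h) ,
  (½ ℚ.* ε , half-pos 0<ε , ev-map (λ n k → right (seq x n) (seq y n) (shrink (seq x n) k)) h)
  where
  shrink : ∀ a {b} → a ℚ.+ ε ℚ.< b → a ℚ.+ (½ ℚ.* ε ℚ.+ ½ ℚ.* ε) ℚ.< b
  shrink a {b} = subst (λ e → a ℚ.+ e ℚ.< b) (sym (half+half ε))
  left : ∀ a b {δ} → a ℚ.+ (δ ℚ.+ δ) ℚ.< b → a ℚ.+ δ ℚ.< b ℚ.- δ
  left a b {δ} k = <-shift k (solve (a ∷ b ∷ δ ∷ []) ℚ-ring)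
  right : ∀ a b {δ} → a ℚ.+ (δ ℚ.+ δ) ℚ.< b → a ℚ.+ δ ℚ.+ δ ℚ.< b
  right a b {δ} k = <-shift k (solve (a ∷ b ∷ δ ∷ []) ℚ-ring)

sub-antimono-≤ : ∀ p {q r} → q ℚ.≤ r → p ℚ.- r ℚ.≤ p ℚ.- q
sub-antimono-≤ p q≤r = ℚ.+-monoʳ-≤ p (ℚ.neg-antimono-≤ q≤r)

-- Compact and convex sets

module _ {d : ℕ} where

  -- Bounding one coordinate at a time gives, for fixed `i`, a cover indexed by a single rational,
  -- and openness needs no minimum over the coordinates.
  Slab : Fin d → ℚ → Pred (ℝ^ d) 0ℓ
  Slab i B x = fromℚ (ℚ.- B) < x i × x i < fromℚ B

  slab-mono : ∀ i {B C} → B ℚ.≤ C → ∀ x → x ∈ Slab i B → x ∈ Slab i C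
  slab-mono i {B} {C} B≤C x (l , u) =
    <-weaken (fromℚ (ℚ.- B)) (x i) (fromℚ (ℚ.- C)) (x i) (λ _ → ℚ.neg-antimono-≤ B≤C) (λ _ → ℚ.≤-refl) l ,
    <-weaken (x i) (fromℚ B) (x i) (fromℚ C) (λ _ → ℚ.≤-refl) (λ _ → B≤C) u

  slab-open : ∀ i B → Open (Slab i B)
  slab-open i B {x} (l , u) = go (<-room (fromℚ (ℚ.- B)) (x i) l) (<-room (x i) (fromℚ B) u)
    where
    go : ∃[ ε ] (0ℚ ℚ.< ε × _ × (∀ z → x i - fromℚ ε < z → fromℚ (ℚ.- B) < z)) →
      ∃[ ε ] (0ℚ ℚ.< ε × (∀ z → z < x i + fromℚ ε → z < fromℚ B) × _) → Interior (Slab i B) x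
    go (ε , 0<ε , _ , above) (η , 0<η , below , _) =
      fromℚ (ε ℚ.⊓ η) , fromℚ-mono-< (⊓-pos 0<ε 0<η) , λ {y} y∈ →
      above (y i) (<-weaken (x i - fromℚ (ε ℚ.⊓ η)) (y i) (x i - fromℚ ε) (y i)
        (λ n → sub-antimono-≤ (seq (x i) n) (ℚ.p⊓q≤p ε η)) (λ _ → ℚ.≤-refl) (proj₁ (y∈ i))) ,
      below (y i) (<-weaken (y i) (x i + fromℚ (ε ℚ.⊓ η)) (y i) (x i + fromℚ η)
        (λ _ → ℚ.≤-refl) (λ n → ℚ.+-monoʳ-≤ (seq (x i) n) (ℚ.p⊓q≤q ε η)) (proj₂ (y∈ i)))

  -- For each coordinate the slabs cover the whole space and increase with `B`, so the largest `B`
  -- of a finite subcover works; then the maximum over the coordinates is taken.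
  compact⇒bounded : ∀ {A} → Compact A → ∃[ B ] (∀ {x} → x ∈ A → ∀ i → x ∈ Slab i B)
  compact⇒bounded {A} compact = proj₁ bound , λ {x} x∈A i →
    slab-mono i (proj₂ bound i) x (proj₂ (coordinate i) {x} x∈A)
    where
    coordinate : ∀ i → ∃[ B ] A ⊆ Slab i B
    coordinate i = proj₁ B , λ {x} x∈A →
      let B′≤B , x∈B′ = All.lookupAny (proj₂ B) (proj₂ subcover {x} x∈A) in slab-mono i B′≤B x x∈B′
      where
      subcover = compact (Slab i) (slab-open i) (λ {x} _ → bounded (x i))
      B = upper-bound (proj₁ subcover)
    bound = upper-boundᶠ (λ i → proj₁ (coordinate i))

  -- This is the exterior of the closed cube of radius δ about `x`. The index carries the positivity
  -- of δ, so that a finite subcover has a positive least radius.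
  Apart : ℝ^ d → ∃ (0ℚ ℚ.<_) → Pred (ℝ^ d) 0ℓ
  Apart x (δ , _) y = ∃[ i ] (y i < x i - fromℚ δ ⊎ x i + fromℚ δ < y i)

  apart-open : ∀ x δ → Open (Apart x δ)
  apart-open x (δ , 0<δ) {y} (i , inj₁ y<x-δ) =
    let ε , 0<ε , below , _ = <-room (y i) (x i - fromℚ δ) y<x-δ in
    fromℚ ε , fromℚ-mono-< 0<ε , λ {z} z∈ → i , inj₁ (below (z i) (proj₂ (z∈ i)))
  apart-open x (δ , 0<δ) {y} (i , inj₂ x+δ<y) =
    let ε , 0<ε , _ , above = <-room (x i + fromℚ δ) (y i) x+δ<y in
    fromℚ ε , fromℚ-mono-< 0<ε , λ {z} z∈ → i , inj₂ (above (z i) (proj₁ (z∈ i)))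

  ¬apart⇒≋ : ∀ x y → (∀ δ → ¬ Apart x δ y) → y ≋ x
  ¬apart⇒≋ x y ¬apart i = ≮∧≯⇒≃ (y i) (x i)
    (λ y<x → let δ , 0<δ , y<x-δ , _ = <-split (y i) (x i) y<x in
      ¬apart (δ , 0<δ) (i , inj₁ y<x-δ))
    (λ x<y → let δ , 0<δ , _ , x+δ<y = <-split (x i) (y i) x<y in
      ¬apart (δ , 0<δ) (i , inj₂ x+δ<y))

  -- The exteriors of the cubes about a point `x` outside `A` cover `A`. The least radius in a
  -- finite subcover gives a ball about `x` that misses `A`.
  compact⇒closed : ExcludedMiddle 0ℓ → ∀ {A} → A Respects _≋_ → Compact A → Open (∁ A)
  compact⇒closed em {A} resp compact {x} x∉A = fromℚ δ , fromℚ-mono-< 0<δ , disjoint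
    where
    covered : A ⊆ ⋃ _ (Apart x)
    covered {y} y∈A = go em
      where
      go : Dec (∃[ δ ] Apart x δ y) → ∃[ δ ] Apart x δ y
      go (yes apart) = apart
      -- A point of `A` that lies in no exterior equals `x`, and `resp` would then put `x` into `A`.
      go (no ¬apart) = contradiction
        (resp {y} {x} (¬apart⇒≋ x y (λ δ a → ¬apart (δ , a))) y∈A) x∉A

    subcover = compact (Apart x) (apart-open x) covered
    lower    = positive-lower-bound (proj₁ subcover)
    δ        = proj₁ lower
    0<δ      = proj₁ (proj₂ lower)

    disjoint : Ball x (fromℚ δ) ⊆ ∁ A
    disjoint {y} y∈ball y∈A = go (Any.lookup separated) (All.lookupAny (proj₂ (proj₂ lower)) separated)
      where
      separated = proj₂ subcover {y} y∈A
      go : ∀ p → ¬ (δ ℚ.≤ proj₁ p × Apart x p y)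
      go (δ′ , _) (δ≤δ′ , i , inj₁ y<x-δ′) = <-asym (y i) (x i - fromℚ δ)
        (<-weaken (y i) (x i - fromℚ δ′) (y i) (x i - fromℚ δ) (λ _ → ℚ.≤-refl)
          (λ n → sub-antimono-≤ (seq (x i) n) δ≤δ′) y<x-δ′)
        (proj₁ (y∈ball i))
      go (δ′ , _) (δ≤δ′ , i , inj₂ x+δ′<y) = <-asym (x i + fromℚ δ) (y i)
        (<-weaken (x i + fromℚ δ′) (y i) (x i + fromℚ δ) (y i)
          (λ n → ℚ.+-monoʳ-≤ (seq (x i) n) δ≤δ′) (λ _ → ℚ.≤-refl) x+δ′<y)
        (proj₂ (y∈ball i))

-- Rational points of a convex body

combine : ℚ → ℚ → ℚ → ℚ
combine t c x = t ℚ.* c ℚ.+ (1ℚ ℚ.- t) ℚ.* x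

-- The point c for which combine t c x ≡ q, when u is the inverse of t.
extrapolate : ℚ → ℚ → ℚ → ℚ → ℚ
extrapolate t u q x = u ℚ.* (q ℚ.- (1ℚ ℚ.- t) ℚ.* x)

module _ {t : ℚ} (0<t : 0ℚ ℚ.< t) where

  -- The combination differs from x by t (c - x), which is smaller than t D < κ in absolute value;
  -- `q` adds an error of at most κ.
  near-endpoint : ∀ {D κ η} c x q → t ℚ.* D ℚ.< κ → η ℚ.≤ κ →
    ℚ.- D ℚ.< c ℚ.- x → c ℚ.- x ℚ.< D → Near η (combine t c x) q → Near (κ ℚ.+ κ) q x
  near-endpoint {D} {κ} {η} c x q tD<κ η≤κ l u k = near
    (<-shift (ℚ.+-mono-< (ℚ.+-mono-<-≤ (above k) η≤κ) (ℚ.+-mono-< (scale u) tD<κ))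
      (eq₁ t c x q D κ η))
    (<-shift (ℚ.+-mono-< (ℚ.+-mono-<-≤ (below k) η≤κ) (ℚ.+-mono-< (scale l) tD<κ))
      (eq₂ t c x q D κ η))
    where
    scale : ∀ {a b} → a ℚ.< b → t ℚ.* a ℚ.< t ℚ.* b
    scale = ℚ.*-monoʳ-<-pos t {{ℚ.positive 0<t}}
    eq₁ : ∀ t c x q D κ η →
      q ℚ.+ ((t ℚ.* c ℚ.+ (1ℚ ℚ.- t) ℚ.* x ℚ.+ η ℚ.+ κ) ℚ.+ (t ℚ.* D ℚ.+ κ)) ≡
      x ℚ.+ (κ ℚ.+ κ) ℚ.+ ((q ℚ.+ η) ℚ.+ (t ℚ.* (c ℚ.- x) ℚ.+ t ℚ.* D))
    eq₁ t c x q D κ η = solve (t ∷ c ∷ x ∷ q ∷ D ∷ κ ∷ η ∷ []) ℚ-ring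
    eq₂ : ∀ t c x q D κ η →
      x ℚ.+ ((q ℚ.+ η ℚ.+ κ) ℚ.+ (t ℚ.* (c ℚ.- x) ℚ.+ κ)) ≡
      q ℚ.+ (κ ℚ.+ κ) ℚ.+ ((t ℚ.* c ℚ.+ (1ℚ ℚ.- t) ℚ.* x ℚ.+ η) ℚ.+ (t ℚ.* (ℚ.- D) ℚ.+ t ℚ.* D))
    eq₂ t c x q D κ η = solve (t ∷ c ∷ x ∷ q ∷ D ∷ κ ∷ η ∷ []) ℚ-ring

  module _ {u : ℚ} (0<u : 0ℚ ℚ.< u) (ut≡1 : u ℚ.* t ≡ 1ℚ) where

    combine-extrapolate : ∀ q x → combine t (extrapolate t u q x) x ≡ q
    combine-extrapolate q x = trans
      (cong (ℚ._+ (1ℚ ℚ.- t) ℚ.* x) (inverse-cancel t u _ (trans (ℚ.*-comm t u) ut≡1)))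
      (sub-add q ((1ℚ ℚ.- t) ℚ.* x))

    -- Extrapolating from `x` multiplies the error of `q` by u = 1 / t, so an error below t σ
    -- becomes one below σ.
    near-centre : ∀ {η σ} c x q → η ℚ.≤ t ℚ.* σ → Near η (combine t c x) q →
      Near σ (extrapolate t u q x) c
    near-centre {η} {σ} c x q η≤tσ k = near
      (subst (extrapolate t u q x ℚ.<_) (inverse-cancel u t (c ℚ.+ σ) ut≡1)
        (scale (<-shift (ℚ.+-mono-<-≤ (above k) η≤tσ) (eq₁ t c x q σ η))))
      (<-shift (subst (ℚ._< extrapolate t u q x) (inverse-cancel u t (c ℚ.- σ) ut≡1)
        (scale (<-shift (ℚ.+-mono-<-≤ (below k) η≤tσ) (eq₂ t c x q σ η))))
        (eq₃ c σ (extrapolate t u q x)))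
      where
      scale : ∀ {a b} → a ℚ.< b → u ℚ.* a ℚ.< u ℚ.* b
      scale = ℚ.*-monoʳ-<-pos u {{ℚ.positive 0<u}}
      eq₁ : ∀ t c x q σ η →
        q ℚ.- (1ℚ ℚ.- t) ℚ.* x ℚ.+ (t ℚ.* c ℚ.+ (1ℚ ℚ.- t) ℚ.* x ℚ.+ η ℚ.+ t ℚ.* σ) ≡
        t ℚ.* (c ℚ.+ σ) ℚ.+ (q ℚ.+ η)
      eq₁ t c x q σ η = solve (t ∷ c ∷ x ∷ q ∷ σ ∷ η ∷ []) ℚ-ring
      eq₂ : ∀ t c x q σ η →
        t ℚ.* (c ℚ.- σ) ℚ.+ (q ℚ.+ η ℚ.+ t ℚ.* σ) ≡
        q ℚ.- (1ℚ ℚ.- t) ℚ.* x ℚ.+ (t ℚ.* c ℚ.+ (1ℚ ℚ.- t) ℚ.* x ℚ.+ η)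
      eq₂ t c x q σ η = solve (t ∷ c ∷ x ∷ q ∷ σ ∷ η ∷ []) ℚ-ring
      eq₃ : ∀ c σ e → c ℚ.+ e ≡ e ℚ.+ σ ℚ.+ (c ℚ.- σ)
      eq₃ c σ e = solve (c ∷ σ ∷ e ∷ []) ℚ-ring

-- One ε is the distance of the sequences, the second is the gap in the resulting real inequalities.
near⇒within : ∀ x y r ε → 0ℚ ℚ.< ε → fromℚ (ε ℚ.+ ε) < r →
  Eventually (λ n → Near ε (seq y n) (seq x n)) → x - r < y × y < x + r
near⇒within x y r ε 0<ε 2ε<r h =
  (ε , 0<ε , ev-zip (λ n → lower (seq x n) (seq y n) (seq r n)) r-large h) ,
  (ε , 0<ε , ev-zip (λ n → upper (seq x n) (seq y n) (seq r n)) r-large h)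
  where
  r-large = <⇒eventually (fromℚ (ε ℚ.+ ε)) r 2ε<r
  lower : ∀ x y r → ε ℚ.+ ε ℚ.< r → Near ε y x → x ℚ.- r ℚ.+ ε ℚ.< y
  lower x y r 2ε<r k = <-shift (ℚ.+-mono-< 2ε<r (above k)) (solve (x ∷ y ∷ r ∷ ε ∷ []) ℚ-ring)
  upper : ∀ x y r → ε ℚ.+ ε ℚ.< r → Near ε y x → y ℚ.+ ε ℚ.< x ℚ.+ r
  upper x y r 2ε<r k = <-shift (ℚ.+-mono-< 2ε<r (below k)) (solve (x ∷ y ∷ r ∷ ε ∷ []) ℚ-ring)

rational-below : ∀ r → 0ℝ < r → ∃[ ε ] (0ℚ ℚ.< ε × fromℚ (ε ℚ.+ ε) < r)
rational-below r 0<r =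
  let δ , 0<δ , _ , 0+δ<r = <-split 0ℝ r 0<r in
  ½ ℚ.* δ , half-pos 0<δ ,
  <-weaken (0ℝ + fromℚ δ) r (fromℚ (½ ℚ.* δ ℚ.+ ½ ℚ.* δ)) r
    (λ _ → ℚ.≤-reflexive (trans (half+half δ) (sym (ℚ.+-identityˡ δ)))) (λ _ → ℚ.≤-refl) 0+δ<r

module _ {d : ℕ} {K : Pred (ℝ^ d) 0ℓ} (K-body : IsConvexBody K) where
  open IsConvexBody K-body

  -- Move `x` slightly towards an interior point `c` and round the result to a rational `q`. Then
  -- `q` is exactly a convex combination of `x` and a point `c′` so close to `c` that it still lies
  -- in `K`.
  rational-point : ∀ {x} → x ∈ K → ∀ r → 0ℝ < r → ∃[ q ] (fromℚ ∘ q ∈ K × fromℚ ∘ q ∈ Ball x r)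
  rational-point {x} x∈K r 0<r = go interior (rational-below r 0<r)
    where
    go : ∃[ c ] c ∈ Interior K → ∃[ ε ] (0ℚ ℚ.< ε × fromℚ (ε ℚ.+ ε) < r) →
      ∃[ q ] (fromℚ ∘ q ∈ K × fromℚ ∘ q ∈ Ball x r)
    go (c , ρ , 0<ρ , ball⊆K) (ε , 0<ε , 2ε<r) = q , q∈K , q∈ball
      where
      κ = ½ ℚ.* ε
      0<κ : 0ℚ ℚ.< κ
      0<κ = half-pos 0<ε

      small-ρ = rational-below ρ 0<ρ
      σ   = proj₁ small-ρ
      0<σ : 0ℚ ℚ.< σ
      0<σ = proj₁ (proj₂ small-ρ)

      distance : ∀ i → ∃[ B ] (fromℚ (ℚ.- B) < c i - x i × c i - x i < fromℚ B)
      distance i = bounded (c i - x i)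
      max-distance = upper-boundᶠ (λ i → proj₁ (distance i))
      D = proj₁ max-distance
      D-bound : ∀ i → c +ᵥ (-ᵥ x) ∈ Slab i D
      D-bound i = slab-mono i (proj₂ max-distance i) (c +ᵥ (-ᵥ x)) (proj₂ (distance i))

      scale = small-multiple D 0<κ
      t     = proj₁ scale
      0<t : 0ℚ ℚ.< t
      0<t = proj₁ (proj₂ scale)
      t≤1 : t ℚ.≤ 1ℚ
      t≤1 = proj₁ (proj₂ (proj₂ scale))
      tD<κ : t ℚ.* D ℚ.< κ
      tD<κ = proj₂ (proj₂ (proj₂ scale))
      t⁻¹ = inverse 0<t
      u   = proj₁ t⁻¹
      0<u : 0ℚ ℚ.< u
      0<u = proj₁ (proj₂ t⁻¹)
      ut≡1 : u ℚ.* t ≡ 1ℚ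
      ut≡1 = proj₂ (proj₂ t⁻¹)

      -- The bound κ keeps `q` near `x`; the bound t σ keeps `c′` in the ball about `c`.
      η = κ ℚ.⊓ (t ℚ.* σ)
      approximation : ∀ i → ∃[ p ] Eventually (λ n → Near η (combine t (seq (c i) n) (seq (x i) n)) p)
      approximation i = approximate (fromℚ t * c i + (1ℝ - fromℚ t) * x i) (⊓-pos 0<κ (*-pos 0<t 0<σ))
      q : Fin d → ℚ
      q i = proj₁ (approximation i)

      c′ : ℝ^ d
      c′ i = fromℚ u * (fromℚ (q i) - (1ℝ - fromℚ t) * x i)

      c′∈K : c′ ∈ K
      c′∈K = ball⊆K {c′} λ i → near⇒within (c i) (c′ i) ρ σ 0<σ (proj₂ (proj₂ small-ρ))
        (ev-map (λ n → near-centre 0<t 0<u ut≡1 (seq (c i) n) (seq (x i) n) (q i) (ℚ.p⊓q≤q κ (t ℚ.* σ)))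
          (proj₂ (approximation i)))

      q∈K : fromℚ ∘ q ∈ K
      q∈K = resp {fromℚ t *ᵥ c′ +ᵥ (1ℝ - fromℚ t) *ᵥ x}
        (λ i → ≡⇒≃ (fromℚ t * c′ i + (1ℝ - fromℚ t) * x i) (fromℚ (q i))
          (λ n → combine-extrapolate 0<t 0<u ut≡1 (q i) (seq (x i) n)))
        (convex {c′} {x} c′∈K x∈K (fromℚ t) (fromℚ-mono-≤ (ℚ.<⇒≤ 0<t)) (fromℚ-mono-≤ t≤1))

      q∈ball : fromℚ ∘ q ∈ Ball x r
      q∈ball i = near⇒within (x i) (fromℚ (q i)) r ε 0<ε 2ε<r
        (ev-zip (λ n (l , u) k → subst (λ e → Near e (q i) (seq (x i) n)) (half+half ε)
            (near-endpoint 0<t (seq (c i) n) (seq (x i) n) (q i) tD<κ (ℚ.p⊓q≤p κ (t ℚ.* σ)) l u k))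
          (ev-zip (λ n → _,_)
            (<⇒eventually (fromℚ (ℚ.- D)) (c i - x i) (proj₁ (D-bound i)))
            (<⇒eventually (c i - x i) (fromℚ D) (proj₂ (D-bound i))))
          (proj₂ (approximation i)))

-- Counting lattice points

module _ (em : ExcludedMiddle 0ℓ) {X : Set} {A : Pred X 0ℓ} where

  #-empty : (∀ x → x ∉ A) → # em A ≡ 0
  #-empty ∉A with em {∃ (HasSize A)}
  -- The junk value coincides with the size of the empty set, so no enumeration has to be exhibited.
  ... | no _                              = refl
  ... | yes (_ , [] , _ , _ , refl)       = refl
  ... | yes (_ , x ∷ _ , _ , mem , refl) = contradiction (Equivalence.to (mem x) (here refl)) (∉A x)

  #-singleton : ∀ a → a ∈ A → (∀ x → x ∈ A → x ≡ a) → # em A ≡ 1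
  #-singleton a a∈A only with em {∃ (HasSize A)}
  -- Here the junk value would be wrong; the enumeration `a ∷ []` rules it out.
  ... | no ¬size = contradiction
    (1 , a ∷ [] , All.[] AllPairs.∷ AllPairs.[] ,
      (λ x → mk⇔ (λ { (here refl) → a∈A }) (λ x∈A → here (only x x∈A))) , refl) ¬size
  ... | yes (_ , [] , _ , mem , refl) with Equivalence.from (mem a) a∈A
  ...   | ()
  #-singleton a a∈A only | yes (_ , _ ∷ [] , _ , _ , refl) = refl
  -- Two entries would both equal `a`, against the absence of duplicates.
  #-singleton a a∈A only | yes (_ , x ∷ y ∷ _ , (x≢y All.∷ _) AllPairs.∷ _ , mem , _) = contradiction
    (trans (only x (Equivalence.to (mem x) (here refl)))
      (sym (only y (Equivalence.to (mem y) (there (here refl)))))) x≢y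

-- Lattice points of translated and scaled sets

≃⇒near : ∀ x y → x ≃ y → ∀ {ε} → 0ℚ ℚ.< ε → Eventually (λ n → Near ε (seq x n) (seq y n))
≃⇒near x y x≃y 0<ε = ev-map (λ n → ∣-∣<⇒near (seq x n) (seq y n)) (x≃y _ 0<ε)

near-scale : ∀ {s ε} p q → 0ℚ ℚ.< s → Near ε p q → Near (s ℚ.* ε) (s ℚ.* p) (s ℚ.* q)
near-scale {s} {ε} p q 0<s k = near (scale q (below k)) (scale p (above k))
  where
  scale : ∀ b {a} → a ℚ.< b ℚ.+ ε → s ℚ.* a ℚ.< s ℚ.* b ℚ.+ s ℚ.* ε
  scale b {a} a<b+ε = subst (s ℚ.* a ℚ.<_) (ℚ.*-distribˡ-+ s b ε)
    (ℚ.*-monoʳ-<-pos s {{ℚ.positive 0<s}} a<b+ε)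

-- This solves z = v (a + w) for a. The first equality is taken with tolerance v ε / 2, which
-- multiplication by σ = 1 / v turns into ε / 2.
untranslate : ∀ {v σ} → 0ℚ ℚ.< v → 0ℚ ℚ.< σ → v ℚ.* σ ≡ 1ℚ → ∀ z w x a →
  fromℚ z ≃ fromℚ v * x → x ≃ a + fromℚ w → a ≃ fromℚ (σ ℚ.* z ℚ.- w)
untranslate {v} {σ} 0<v 0<σ vσ≡1 z w x a z≃vx x≃a+w ε 0<ε = ev-zip
  (λ n k l → near⇒∣-∣< (seq a n) (σ ℚ.* z ℚ.- w) (subst (λ e → Near e (seq a n) (σ ℚ.* z ℚ.- w)) (half+half ε)
    (combine-near (σ ℚ.* z) (seq x n) (seq a n) (½ ℚ.* ε) (unscale (seq x n) k) l)))
  (≃⇒near (fromℚ z) (fromℚ v * x) z≃vx (*-pos 0<v (half-pos 0<ε)))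
  (≃⇒near x (a + fromℚ w) x≃a+w (half-pos 0<ε))
  where
  σv≡1 : σ ℚ.* v ≡ 1ℚ
  σv≡1 = trans (ℚ.*-comm σ v) vσ≡1
  unscale : ∀ x → Near (v ℚ.* (½ ℚ.* ε)) z (v ℚ.* x) → Near (½ ℚ.* ε) (σ ℚ.* z) x
  unscale x k = subst₂ (λ e y → Near e (σ ℚ.* z) y)
    (inverse-cancel σ v _ σv≡1) (inverse-cancel σ v x σv≡1) (near-scale z (v ℚ.* x) 0<σ k)
  combine-near : ∀ y x a e → Near e y x → Near e x (a ℚ.+ w) → Near (e ℚ.+ e) a (y ℚ.- w)
  combine-near y x a e k l = near
    (<-shift (ℚ.+-mono-< (above k) (above l)) (solve (y ∷ x ∷ a ∷ e ∷ w ∷ []) ℚ-ring))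
    (<-shift (ℚ.+-mono-< (below k) (below l)) (solve (y ∷ x ∷ a ∷ e ∷ w ∷ []) ℚ-ring))

-- The gap of each strict inequality serves as the tolerance in the equality of `x` and `r`.
rational-bounds : ∀ x {r p q} → x ≃ fromℚ r → fromℚ p < x → x < fromℚ q → p ℚ.< r × r ℚ.< q
rational-bounds x {r} {p} {q} x≃r (ε , 0<ε , h) (η , 0<η , k) =
  ev-const (ev-zip (λ n p+ε<x l → lower (seq x n) p+ε<x (below l)) h (≃⇒near x (fromℚ r) x≃r 0<ε)) ,
  ev-const (ev-zip (λ n x+η<q l → ℚ.<-trans (above l) x+η<q) k (≃⇒near x (fromℚ r) x≃r 0<η))
  where
  lower : ∀ x {ε} → p ℚ.+ ε ℚ.< x → x ℚ.< r ℚ.+ ε → p ℚ.< r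
  lower x {ε} a b = <-shift (ℚ.+-mono-< a b) (solve (x ∷ r ∷ p ∷ ε ∷ []) ℚ-ring)

-- Subtracting the bounds gives σ (a - b) < 2B < σ, hence a < b + 1, and integrality does the rest.
close⇒≤ : ∀ {σ B} w a b → 0ℚ ℚ.< σ → B ℚ.+ B ℚ.< σ →
  ℚ.- B ℚ.< σ ℚ.* int b ℚ.- w → σ ℚ.* int a ℚ.- w ℚ.< B → a ℤ.≤ b
close⇒≤ {σ} {B} w a b 0<σ 2B<σ l u = int<int+1⇒≤ a b
  (ℚ.*-cancelˡ-<-nonNeg σ {{ℚ.nonNegative (ℚ.<⇒≤ 0<σ)}}
    (<-shift (ℚ.+-mono-< (ℚ.+-mono-< l u) 2B<σ) (eq σ B w (int a) (int b))))
  where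
  eq : ∀ σ B w a b → σ ℚ.* a ℚ.+ (σ ℚ.* b ℚ.- w ℚ.+ B ℚ.+ σ) ≡
    σ ℚ.* (b ℚ.+ 1ℚ) ℚ.+ (ℚ.- B ℚ.+ (σ ℚ.* a ℚ.- w) ℚ.+ (B ℚ.+ B))
  eq σ B w a b = solve (σ ∷ B ∷ w ∷ a ∷ b ∷ []) ℚ-ring

lookup-injective : ∀ {X : Set} {n} (xs ys : Vec X n) → (∀ i → Vec.lookup xs i ≡ Vec.lookup ys i) → xs ≡ ys
lookup-injective xs ys eq = trans (sym (Vec.tabulate∘lookup xs))
  (trans (Vec.tabulate-cong eq) (Vec.tabulate∘lookup ys))

-- `s` and `w` are chosen from `q` and `B` before `A` is given, so that one pair tests both bodies.
detect-rational-point : (em : ExcludedMiddle 0ℓ) → ∀ {d} (q : Fin d → ℚ) B →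
  (∀ i → ℚ.- B ℚ.< q i × q i ℚ.< B) →
  ∃[ s ] (0ℝ < s × ∃[ w ] (∀ {A} → A Respects _≋_ → (∀ {x} → x ∈ A → ∀ i → x ∈ Slab i B) →
    (fromℚ ∘ q ∈ A → L em (A ⊕ ι w) s ≡ 1) × (fromℚ ∘ q ∉ A → L em (A ⊕ ι w) s ≡ 0)))
detect-rational-point em {d} q B q-bound = s , fromℚ-mono-< 0<v , w , λ {A} resp A-bound →
  (λ q∈A → #-singleton em z (contains {A} q∈A) (λ z′ z′∈ → proj₁ (only resp A-bound z′ z′∈))) ,
  (λ q∉A → #-empty em (λ z′ z′∈ → q∉A (proj₂ (only resp A-bound z′ z′∈))))
  where
  cleared = common-denominator q
  p  = int (proj₁ cleared)
  zᵢ = proj₁ (proj₂ (proj₂ cleared))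
  pq≡z : ∀ i → p ℚ.* q i ≡ int (zᵢ i)
  pq≡z = proj₂ (proj₂ (proj₂ cleared))
  p⁻¹ = inverse (proj₁ (proj₂ cleared))
  τ   = proj₁ p⁻¹
  0<τ : 0ℚ ℚ.< τ
  0<τ = proj₁ (proj₂ p⁻¹)
  τp≡1 : τ ℚ.* p ≡ 1ℚ
  τp≡1 = proj₂ (proj₂ p⁻¹)

  -- Since m is at least 2B, σ = m + 1 / p exceeds the side 2B of the bounding cube: at most one
  -- point of the lattice of spacing σ, shifted by -w, fits into it.
  m = proj₁ (archimedean (B ℚ.+ B))
  μ = int (ℤ.+ m)
  σ = μ ℚ.+ τ
  0<σ : 0ℚ ℚ.< σ
  0<σ = ℚ.+-mono-≤-< (ℚ.nonNegative⁻¹ μ {{ℚ.normalize-nonNeg m 1}}) 0<τ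
  2B<σ : B ℚ.+ B ℚ.< σ
  2B<σ = subst (ℚ._< σ) (ℚ.+-identityʳ (B ℚ.+ B)) (ℚ.+-mono-≤-< (proj₂ (archimedean (B ℚ.+ B))) 0<τ)
  σ⁻¹ = inverse 0<σ
  v   = proj₁ σ⁻¹
  0<v : 0ℚ ℚ.< v
  0<v = proj₁ (proj₂ σ⁻¹)
  vσ≡1 : v ℚ.* σ ≡ 1ℚ
  vσ≡1 = proj₂ (proj₂ σ⁻¹)

  s : ℝ
  s = fromℚ v
  z w : Vec ℤ d
  z = Vec.tabulate zᵢ
  -- With this `w`, the sum q + w = z / p + m z is σ z.
  w = Vec.tabulate (λ i → ℤ.+ m ℤ.* zᵢ i)
  W Z : Fin d → ℚ
  W i = int (Vec.lookup w i)
  Z i = int (Vec.lookup z i)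

  q+w≡σz : ∀ i → q i ℚ.+ W i ≡ σ ℚ.* Z i
  q+w≡σz i = trans (cong₂ ℚ._+_ q≡τz W≡μz) (factor τ μ (Z i))
    where
    Z≡ : int (zᵢ i) ≡ Z i
    Z≡ = cong int (sym (Vec.lookup∘tabulate zᵢ i))
    q≡τz : q i ≡ τ ℚ.* Z i
    q≡τz = trans (sym (inverse-cancel τ p (q i) τp≡1)) (cong (τ ℚ.*_) (trans (pq≡z i) Z≡))
    W≡μz : W i ≡ μ ℚ.* Z i
    W≡μz = trans (cong int (Vec.lookup∘tabulate (λ i → ℤ.+ m ℤ.* zᵢ i) i))
      (trans (int-* (ℤ.+ m) (zᵢ i)) (cong (μ ℚ.*_) Z≡))
    factor : ∀ τ μ z → τ ℚ.* z ℚ.+ μ ℚ.* z ≡ (μ ℚ.+ τ) ℚ.* z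
    factor τ μ z = solve (τ ∷ μ ∷ z ∷ []) ℚ-ring

  q≡σz-w : ∀ i → q i ≡ σ ℚ.* Z i ℚ.- W i
  q≡σz-w i = trans (cancel (q i) (W i)) (cong (ℚ._- W i) (q+w≡σz i))
    where
    cancel : ∀ a b → a ≡ a ℚ.+ b ℚ.- b
    cancel a b = solve (a ∷ b ∷ []) ℚ-ring

  contains : ∀ {A} → fromℚ ∘ q ∈ A → ι z ∈ s · (A ⊕ ι w)
  contains q∈A = (fromℚ ∘ q) +ᵥ ι w , (fromℚ ∘ q , q∈A ,
      λ i → ≡⇒≃ (fromℚ (q i) + ι w i) (fromℚ (q i) + ι w i) (λ _ → refl)) ,
    λ i → ≡⇒≃ (ι z i) (s * (fromℚ (q i) + ι w i))
      (λ _ → sym (trans (cong (v ℚ.*_) (q+w≡σz i)) (inverse-cancel v σ (Z i) vσ≡1)))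

  -- A lattice point z′ of the set comes from a = σ z′ - w in `A`. Both a and q = σ z - w lie in the
  -- cube, which forces z′ = z and then a = q. This yields uniqueness if `q` is in `A` and emptiness
  -- if not.
  only : ∀ {A} → A Respects _≋_ → (∀ {x} → x ∈ A → ∀ i → x ∈ Slab i B) →
    ∀ z′ → ι z′ ∈ s · (A ⊕ ι w) → z′ ≡ z × fromℚ ∘ q ∈ A
  only resp A-bound z′ (x , (a , a∈A , x≋a+w) , z′≋sx) = z′≡z , resp {a} {fromℚ ∘ q} a≋q a∈A
    where
    r : Fin d → ℚ
    r i = σ ℚ.* int (Vec.lookup z′ i) ℚ.- W i
    a≋r : ∀ i → a i ≃ fromℚ (r i)
    a≋r i = untranslate 0<v 0<σ vσ≡1 (int (Vec.lookup z′ i)) (W i) (x i) (a i) (z′≋sx i) (x≋a+w i)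
    r-bound : ∀ i → ℚ.- B ℚ.< r i × r i ℚ.< B
    r-bound i = let l , u = A-bound {a} a∈A i in rational-bounds (a i) (a≋r i) l u
    σz-w-bound : ∀ i → ℚ.- B ℚ.< σ ℚ.* Z i ℚ.- W i × σ ℚ.* Z i ℚ.- W i ℚ.< B
    σz-w-bound i = subst (λ c → ℚ.- B ℚ.< c × c ℚ.< B) (q≡σz-w i) (q-bound i)
    z′≡z : z′ ≡ z
    z′≡z = lookup-injective z′ z λ i → ℤ.≤-antisym
      (close⇒≤ (W i) (Vec.lookup z′ i) (Vec.lookup z i) 0<σ 2B<σ (proj₁ (σz-w-bound i)) (proj₂ (r-bound i)))
      (close⇒≤ (W i) (Vec.lookup z i) (Vec.lookup z′ i) 0<σ 2B<σ (proj₁ (r-bound i)) (proj₂ (σz-w-bound i)))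
    a≋q : a ≋ (fromℚ ∘ q)
    a≋q i = subst (λ c → a i ≃ fromℚ c)
      (trans (cong (λ y → σ ℚ.* int (Vec.lookup y i) ℚ.- W i) z′≡z) (sym (q≡σz-w i))) (a≋r i)

-- Comparison of the two bodies

counts-agree⇒⊆ : (em : ExcludedMiddle 0ℓ) → ∀ {d} {K H : Pred (ℝ^ d) 0ℓ} →
  IsConvexBody K → IsConvexBody H →
  (∀ s → 0ℝ < s → ∀ w → L em (K ⊕ ι w) s ≡ L em (H ⊕ ι w) s) → K ⊆ H
counts-agree⇒⊆ em {K = K} {H} K-body H-body agree {x} x∈K = go em
  where
  module K = IsConvexBody K-body
  module H = IsConvexBody H-body

  separated : Interior (∁ H) x → x ∈ H
  -- For a rational point `q` of `K` in a ball outside `H`, the counts are 1 and 0, so `agree` would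
  -- give 1 ≡ 0.
  separated (r , 0<r , ball⊆∁H) = contradiction
    (trans (sym (proj₁ (detect K.resp K-bound) q∈K))
      (trans (agree s 0<s w) (proj₂ (detect H.resp H-bound) (ball⊆∁H {fromℚ ∘ q} q∈ball))))
    λ ()
    where
    point = rational-point K-body {x} x∈K r 0<r
    q = proj₁ point
    q∈K : fromℚ ∘ q ∈ K
    q∈K = proj₁ (proj₂ point)
    q∈ball : fromℚ ∘ q ∈ Ball x r
    q∈ball = proj₂ (proj₂ point)

    bound-K = compact⇒bounded K.compact
    bound-H = compact⇒bounded H.compact
    -- A common bound is taken because the same `s` and `w` must work for `K` and for `H`.
    B = proj₁ bound-K ℚ.⊔ proj₁ bound-H
    K-bound : ∀ {x} → x ∈ K → ∀ i → x ∈ Slab i B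
    K-bound {x} x∈K i = slab-mono i (ℚ.p≤p⊔q (proj₁ bound-K) (proj₁ bound-H)) x (proj₂ bound-K {x} x∈K i)
    H-bound : ∀ {x} → x ∈ H → ∀ i → x ∈ Slab i B
    H-bound {x} x∈H i = slab-mono i (ℚ.p≤q⊔p (proj₁ bound-K) (proj₁ bound-H)) x (proj₂ bound-H {x} x∈H i)
    q-bound : ∀ i → ℚ.- B ℚ.< q i × q i ℚ.< B
    q-bound i = let l , u = K-bound {fromℚ ∘ q} q∈K i in
      rational-bounds (fromℚ (q i)) {q i} {ℚ.- B} {B} (≡⇒≃ (fromℚ (q i)) (fromℚ (q i)) (λ _ → refl)) l u

    detector = detect-rational-point em q B q-bound
    s = proj₁ detector
    0<s = proj₁ (proj₂ detector)
    w = proj₁ (proj₂ (proj₂ detector))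
    detect : ∀ {A} → A Respects _≋_ → (∀ {x} → x ∈ A → ∀ i → x ∈ Slab i B) →
      (fromℚ ∘ q ∈ A → L em (A ⊕ ι w) s ≡ 1) × (fromℚ ∘ q ∉ A → L em (A ⊕ ι w) s ≡ 0)
    detect = proj₂ (proj₂ (proj₂ detector))

  go : Dec (x ∈ H) → x ∈ H
  go (yes x∈H) = x∈H
  go (no x∉H)  = separated (compact⇒closed em H.resp H.compact x∉H)

theorem2 : (em : ExcludedMiddle 0ℓ) →
    ∀ (d : ℕ) (K H : Pred (ℝ^ d) 0ℓ) →
    IsConvexBody K → Symmetric K →
    IsConvexBody H → Symmetric H →
    (∀ (s : ℝ) → 0ℝ < s → ∀ (w : Vec ℤ d) → L em (K ⊕ ι w) s ≡ L em (H ⊕ ι w) s) →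
    K ≐ H
theorem2 em d K H K-body _ H-body _ agree =
  counts-agree⇒⊆ em K-body H-body agree ,
  counts-agree⇒⊆ em H-body K-body (λ s 0<s w → sym (agree s 0<s w))
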